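{- Let $n\ge 2$ be an integer. If $H \in \mathcal{H}_n$, then $\gamma^{\rm ID}(H\Box K_2) = |V(H)|$.
   Context: All graphs are finite, simple and undirected. For an integer $n\ge 2$, $\mathcal{H}_n$ is the class of all finite graphs that can be obtained from some connected graph $F$ of order $n$ by attaching, to each of the $n$ vertices of $F$, at least one new vertex of degree $1$ adjacent to it (the number of attached degree-1 vertices may vary from vertex to vertex). $N[x]$ denotes the closed neighborhood of a vertex $x$. An identifying code (ID code) of a graph $F$ is a set $C\subseteq V(F)$ such that $N[x]\cap C\neq\emptyset$ for every vertex $x$ and $N[x]\cap C\neq N[y]\cap C$ for all distinct vertices $x,y$; $\gamma^{\rm ID}(F)$ is the minimum cardinality of an ID code of $F$. $\Box$ denotes the Cartesian product of graphs. -}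

module Defs where

open import Data.Empty using (⊥)
open import Data.Fin.Base using (Fin)
import Data.Fin.Properties as Fin
open import Data.Fin.Subset using (Subset; Nonempty; _∩_; ∣_∣)
open import Data.Nat.Base using (ℕ; _+_; _*_; _≤_)
open import Data.Product.Base using (_×_; _,_; ∃; ∃-syntax; Σ-syntax)
open import Data.Product.Function.NonDependent.Propositional using (_×-↔_)
open import Data.Sum.Base using (_⊎_; inj₁; inj₂; map)
open import Data.Sum.Function.Propositional using (_⊎-↔_)
open import Data.Vec.Base using (tabulate)
open import Function.Bundles using (_↔_; _⇔_; Inverse)
open import Function.Construct.Identity using (↔-id)
open import Function.Definitions using (StrictlySurjective)
open import Function.Properties.Inverse
  using (Inverse⇒Injection; ↔-sym; ↔-trans)
open import Level using (0ℓ) renaming (suc to lsuc)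
open import Relation.Binary.Construct.Closure.ReflexiveTransitive using (Star)
open import Relation.Binary.Core using (Rel)
open import Relation.Binary.Definitions
  using (Decidable; DecidableEquality; Irreflexive; Symmetric)
open import Relation.Binary.PropositionalEquality
  using (_≡_; _≢_; refl; sym; ≢-sym)
open import Relation.Nullary.Decidable
  using (does; no; ¬?; _×-dec_; _⊎-dec_; via-injection)
open import Relation.Unary using (Pred)

record Graph : Set₁ where
  field
    V      : Set
    order  : ℕ
    enum   : V ↔ Fin order
    Adj    : Rel V 0ℓ
    adj?   : Decidable Adj
    symm   : Symmetric Adj
    irrefl : Irreflexive _≡_ Adj

  _≟_ : DecidableEquality V
  _≟_ = via-injection (Inverse⇒Injection enum) Fin._≟_

  -- Sets of vertices are represented as subsets of Fin order, through enum.
  VertexSet : Set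
  VertexSet = Subset order

  N[_] : V → VertexSet
  N[ x ] = tabulate λ i →
    let y = Inverse.from enum i in does ((y ≟ x) ⊎-dec adj? x y)

open Graph using (V; order)

Connected : Graph → Set
Connected G = ∀ x y → Star (Graph.Adj G) x y

infix 4 _≅_

_≅_ : Graph → Graph → Set
G ≅ H = Σ[ φ ∈ V G ↔ V H ]
  (∀ x y → Graph.Adj G x y ⇔ Graph.Adj H (Inverse.to φ x) (Inverse.to φ y))

K : ℕ → Graph
K n = record
  { V      = Fin n
  ; order  = n
  ; enum   = ↔-id (Fin n)
  ; Adj    = _≢_
  ; adj?   = λ i j → ¬? (i Fin.≟ j)
  ; symm   = ≢-sym
  ; irrefl = λ i≡j i≢j → i≢j i≡j
  }

infixl 7 _□_

_□_ : Graph → Graph → Graph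
G □ H = record
  { V      = V G × V H
  ; order  = order G * order H
  ; enum   = ↔-trans (G.enum ×-↔ H.enum) (↔-sym Fin.*↔×)
  ; Adj    = λ (x , a) (y , b) → (x ≡ y × H.Adj a b) ⊎ (G.Adj x y × a ≡ b)
  ; adj?   = λ (x , a) (y , b) →
               ((x G.≟ y) ×-dec H.adj? a b) ⊎-dec (G.adj? x y ×-dec (a H.≟ b))
  ; symm   = map (λ (p , e) → sym p , H.symm e) (λ (e , p) → G.symm e , sym p)
  ; irrefl = λ { refl (inj₁ (_ , e)) → H.irrefl refl e
               ; refl (inj₂ (e , _)) → G.irrefl refl e }
  }
  where
  module G = Graph G
  module H = Graph H

-- Attach k new vertices of degree 1 to F, the ℓ-th one adjacent to host ℓ.
attach : (F : Graph) {k : ℕ} → (Fin k → V F) → Graph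
attach F {k} host = record
  { V      = V F ⊎ Fin k
  ; order  = order F + k
  ; enum   = ↔-trans (F.enum ⊎-↔ ↔-id (Fin k)) (↔-sym Fin.+↔⊎)
  ; Adj    = Adj
  ; adj?   = adj?
  ; symm   = λ {x} {y} → symm x y
  ; irrefl = λ { {inj₁ _} refl → F.irrefl refl ; {inj₂ _} refl () }
  }
  where
  module F = Graph F

  Adj : Rel (V F ⊎ Fin k) 0ℓ
  Adj (inj₁ u) (inj₁ v) = F.Adj u v
  Adj (inj₁ u) (inj₂ ℓ) = host ℓ ≡ u
  Adj (inj₂ ℓ) (inj₁ u) = host ℓ ≡ u
  Adj (inj₂ _) (inj₂ _) = ⊥

  adj? : Decidable Adj
  adj? (inj₁ u) (inj₁ v) = F.adj? u v
  adj? (inj₁ u) (inj₂ ℓ) = host ℓ F.≟ u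
  adj? (inj₂ ℓ) (inj₁ u) = host ℓ F.≟ u
  adj? (inj₂ _) (inj₂ _) = no λ ()

  symm : ∀ x y → Adj x y → Adj y x
  symm (inj₁ _) (inj₁ _) e = F.symm e
  symm (inj₁ _) (inj₂ _) e = e
  symm (inj₂ _) (inj₁ _) e = e

-- Surjectivity of host: every vertex of F gets at least one new neighbour.
ℋ : ℕ → Pred Graph (lsuc 0ℓ)
ℋ n H = Σ[ F ∈ Graph ] order F ≡ n × Connected F ×
  ∃[ k ] Σ[ host ∈ (Fin k → V F) ]
    StrictlySurjective _≡_ host × H ≅ attach F host

record IsIDCode (G : Graph) (C : Graph.VertexSet G) : Set where
  open Graph G using (N[_])
  field
    dominating : ∀ x → Nonempty (N[ x ] ∩ C)
    separating : ∀ x y → x ≢ y → N[ x ] ∩ C ≢ N[ y ] ∩ C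

-- A relation rather than a function: a graph with two vertices of equal
-- closed neighbourhood has no ID code, hence no value k.
infix 4 γᴵᴰ[_]≡_

record γᴵᴰ[_]≡_ (G : Graph) (k : ℕ) : Set where
  field
    attained : ∃ λ C → IsIDCode G C × ∣ C ∣ ≡ k
    minimal  : ∀ C → IsIDCode G C → k ≤ ∣ C ∣

{-# OPTIONS --safe #-}

-- A pendant vertex ℓ at u has only u as a neighbour, so (ℓ , 0) and (ℓ , 1)
-- can only be separated by (u , 0) or (u , 1).  Hence a column {x} × K 2 missed
-- by the code C is that of a pendant vertex x; domination then puts both
-- (u , 0) and (u , 1) in C, and separation allows one missed column for each u.
-- Charging a missed column to (u , 1), and every other column to its lowest
-- vertex in C, is injective, whence |V H| ≤ |C|.  Conversely V H × {0} is an
-- ID code because H has neither isolated vertices nor closed twins.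
module Submission where

open import Defs
open import Data.Bool.Base using (true)
open import Data.Fin.Base using (Fin; zero; suc; combine; punchIn)
open import Data.Fin.Patterns using (0F; 1F)
import Data.Fin.Properties as Fin
open import Data.Fin.Subset as Subset
  using (Subset; inside; outside; _∩_; ∣_∣; _⊆_)
open import Data.Fin.Subset.Properties
  using (⊆-antisym; x∈p∩q⁺; x∈p∩q⁻; _∈?_)
open import Data.Nat.Base using (ℕ; suc; _*_; _≤_; s≤s)
open import Data.Product.Base using (_×_; _,_; ∃-syntax; proj₁; proj₂)
open import Data.Sum.Base using (_⊎_; inj₁; inj₂)
open import Data.Vec.Base using ([]; _∷_; here; there)
open import Data.Vec.Properties using ([]=⇒lookup; lookup⇒[]=; lookup∘tabulate)
open import Function.Base using (_∘_)
open import Function.Bundles using (Inverse; Equivalence)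
open import Function.Definitions using (StrictlySurjective)
open import Relation.Binary.Construct.Closure.ReflexiveTransitive using (ε; _◅_)
open import Relation.Binary.PropositionalEquality
  using (_≡_; _≢_; refl; sym; trans; cong; subst)
open import Relation.Nullary using (¬_; Dec; yes; no; contradiction)
open import Relation.Nullary.Decidable using (does; dec-true; decidable-stable; _⊎-dec_)
open import Relation.Unary using (_∈_)

-- Cardinalities of subsets of `Fin n`.

dec-true⁻ : ∀ {A : Set} (a? : Dec A) → does a? ≡ true → A
dec-true⁻ (yes a) _ = a

rank : ∀ {n} (p : Subset n) {i} → i Subset.∈ p → Fin ∣ p ∣
rank (inside  ∷ p) here        = zero
rank (inside  ∷ p) (there i∈p) = suc (rank p i∈p)
rank (outside ∷ p) (there i∈p) = rank p i∈p

rank-injective : ∀ {n} (p : Subset n) {i j} (i∈p : i Subset.∈ p) (j∈p : j Subset.∈ p) →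
                 rank p i∈p ≡ rank p j∈p → i ≡ j
rank-injective (inside  ∷ p) here        here        _  = refl
rank-injective (inside  ∷ p) (there i∈p) (there j∈p) eq =
  cong suc (rank-injective p i∈p j∈p (Fin.suc-injective eq))
rank-injective (outside ∷ p) (there i∈p) (there j∈p) eq =
  cong suc (rank-injective p i∈p j∈p eq)

injective-into⇒≤ : ∀ {m n} (p : Subset n) (f : Fin m → Fin n) → (∀ i → f i Subset.∈ p) →
                   (∀ {i j} → f i ≡ f j → i ≡ j) → m ≤ ∣ p ∣
injective-into⇒≤ p f f∈p f-inj =
  Fin.injective⇒≤ {f = λ i → rank p (f∈p i)}
    (λ {i} {j} eq → f-inj (rank-injective p (f∈p i) (f∈p j) eq))

-- The enumeration of `H □ K 2` gives (x , b) the index 2i + b, where i is the index of x, so the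
-- even positions form the layer V H × {0}.
evens : ∀ n → Subset (n * 2)
evens 0       = []
evens (suc n) = inside ∷ outside ∷ evens n

∣evens∣ : ∀ n → ∣ evens n ∣ ≡ n
∣evens∣ 0       = refl
∣evens∣ (suc n) = cong suc (∣evens∣ n)

∈evens⁺ : ∀ {n} (i : Fin n) → combine {n = 2} i 0F Subset.∈ evens n
∈evens⁺ zero    = here
∈evens⁺ (suc i) = there (there (∈evens⁺ i))

∈evens⁻ : ∀ {n} (i : Fin n) (b : Fin 2) → combine i b Subset.∈ evens n → b ≡ 0F
∈evens⁻ zero    0F _                 = refl
∈evens⁻ zero    1F (there ())
∈evens⁻ (suc i) b  (there (there h)) = ∈evens⁻ i b h

another : ∀ {n} → 2 ≤ n → (i : Fin n) → ∃[ j ] j ≢ i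
another (s≤s (s≤s _)) i = punchIn i zero , Fin.punchInᵢ≢i i zero

-- Neighbourhoods and ID codes in terms of vertices instead of indices.

module _ (G : Graph) where
  open Graph G
  open Inverse enum using (to; from; strictlyInverseˡ; strictlyInverseʳ)

  infix 4 _∈ⱽ_

  _∈ⱽ_ : V → VertexSet → Set
  x ∈ⱽ C = to x Subset.∈ C

  Nbr : V → V → Set
  Nbr x y = y ≡ x ⊎ Adj x y

  to-injective : ∀ {x y} → to x ≡ to y → x ≡ y
  to-injective {x} {y} eq =
    trans (sym (strictlyInverseʳ x)) (trans (cong from eq) (strictlyInverseʳ y))

  private
    nbr? : ∀ x y → Dec (Nbr x y)
    nbr? x y = (y ≟ x) ⊎-dec adj? x y

  ∈N⁺ : ∀ {x y} → Nbr x y → y ∈ⱽ N[ x ]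
  ∈N⁺ {x} {y} nbr = lookup⇒[]= (to y) N[ x ]
    (trans (lookup∘tabulate _ (to y))
      (dec-true (nbr? x (from (to y))) (subst (Nbr x) (sym (strictlyInverseʳ y)) nbr)))

  ∈N⁻ : ∀ {x y} → y ∈ⱽ N[ x ] → Nbr x y
  ∈N⁻ {x} {y} y∈N = subst (Nbr x) (strictlyInverseʳ y)
    (dec-true⁻ (nbr? x (from (to y)))
      (trans (sym (lookup∘tabulate _ (to y))) ([]=⇒lookup y∈N)))

  NbrIn⊆ : VertexSet → V → V → Set
  NbrIn⊆ C x y = ∀ {v} → v ∈ⱽ C → Nbr x v → Nbr y v

  N∩-mono : ∀ {C x y} → NbrIn⊆ C x y → N[ x ] ∩ C ⊆ N[ y ] ∩ C
  N∩-mono {C} {x} {y} sub {i} i∈ with x∈p∩q⁻ N[ x ] C i∈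
  ... | i∈N , i∈C = subst (Subset._∈ N[ y ] ∩ C) to-from
      (x∈p∩q⁺ (∈N⁺ (sub v∈C (∈N⁻ v∈N)) , v∈C))
    where
    to-from : to (from i) ≡ i
    to-from = strictlyInverseˡ i
    v∈C : from i ∈ⱽ C
    v∈C = subst (Subset._∈ C) (sym to-from) i∈C
    v∈N : from i ∈ⱽ N[ x ]
    v∈N = subst (Subset._∈ N[ x ]) (sym to-from) i∈N

  N∩-mono⁻ : ∀ {C x y} → N[ x ] ∩ C ≡ N[ y ] ∩ C → NbrIn⊆ C x y
  N∩-mono⁻ {C} {x} {y} eq v∈C nbr =
    ∈N⁻ (proj₁ (x∈p∩q⁻ N[ y ] C (subst (_ Subset.∈_) eq (x∈p∩q⁺ (∈N⁺ nbr , v∈C)))))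

  isIDCode⁺ : ∀ {C} → (∀ x → ∃[ v ] Nbr x v × v ∈ⱽ C) →
              (∀ x y → NbrIn⊆ C x y → NbrIn⊆ C y x → x ≡ y) → IsIDCode G C
  isIDCode⁺ dom sep = record
    { dominating = λ x → let v , nbr , v∈C = dom x in to v , x∈p∩q⁺ (∈N⁺ nbr , v∈C)
    ; separating = λ x y x≢y eq → x≢y (sep x y (N∩-mono⁻ eq) (N∩-mono⁻ (sym eq)))
    }

  module _ {C} (code : IsIDCode G C) where
    open IsIDCode code

    dominated : ∀ x → ∃[ v ] Nbr x v × v ∈ⱽ C
    dominated x with dominating x
    ... | i , i∈ with x∈p∩q⁻ N[ x ] C i∈
    ...   | i∈N , i∈C = from i , ∈N⁻ (subst (Subset._∈ N[ x ]) i≡ i∈N) , subst (Subset._∈ C) i≡ i∈C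
      where
      i≡ : i ≡ to (from i)
      i≡ = sym (strictlyInverseˡ i)

    separated : ∀ {x y} → NbrIn⊆ C x y → NbrIn⊆ C y x → x ≡ y
    -- Separation only refutes x ≢ y; decidable equality of vertices makes this positive.
    separated {x} {y} x⊆y y⊆x = decidable-stable (x ≟ y)
      (λ x≢y → separating x y x≢y (⊆-antisym (N∩-mono x⊆y) (N∩-mono y⊆x)))

  TwinFree : Set
  TwinFree = ∀ x y → (∀ {v} → Nbr x v → Nbr y v) → (∀ {v} → Nbr y v → Nbr x v) → x ≡ y

  Pendant : V → V → Set
  Pendant x y = Adj x y × (∀ {z} → Adj x z → z ≡ y)

  -- What membership in `ℋ n` says about a single vertex, in a form that transports along
  -- isomorphisms.
  PendantOrSupport : V → Set
  PendantOrSupport x = (∃[ ℓ ] Pendant ℓ x) ⊎ (∃[ u ] Pendant x u)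

-- The prism `H □ K 2` and its layer 0 as an ID code.

module _ (H : Graph) where
  open Graph H

  private
    P : Graph
    P = H □ K 2

  layer₀ : Graph.VertexSet P
  layer₀ = evens order

  ∈layer₀⁺ : ∀ x → _∈ⱽ_ P (x , 0F) layer₀
  ∈layer₀⁺ x = ∈evens⁺ (Inverse.to enum x)

  ∈layer₀⁻ : ∀ {x} b → _∈ⱽ_ P (x , b) layer₀ → b ≡ 0F
  ∈layer₀⁻ {x} b = ∈evens⁻ (Inverse.to enum x) b

  Nbr-same⁺ : ∀ {x y b} → Nbr H x y → Nbr P (x , b) (y , b)
  Nbr-same⁺ (inj₁ refl) = inj₁ refl
  Nbr-same⁺ (inj₂ adj)  = inj₂ (inj₂ (adj , refl))

  Nbr-same⁻ : ∀ {x y b} → Nbr P (x , b) (y , b) → Nbr H x y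
  Nbr-same⁻ (inj₁ refl)             = inj₁ refl
  Nbr-same⁻ (inj₂ (inj₁ (_ , b≢b))) = contradiction refl b≢b
  Nbr-same⁻ (inj₂ (inj₂ (adj , _))) = inj₂ adj

  Nbr-cross⁺ : ∀ {x a b} → a ≢ b → Nbr P (x , a) (x , b)
  Nbr-cross⁺ a≢b = inj₂ (inj₁ (refl , a≢b))

  Nbr-cross⁻ : ∀ {x y a b} → a ≢ b → Nbr P (x , a) (y , b) → x ≡ y
  Nbr-cross⁻ a≢b (inj₁ refl)             = refl
  Nbr-cross⁻ a≢b (inj₂ (inj₁ (x≡y , _))) = x≡y
  Nbr-cross⁻ a≢b (inj₂ (inj₂ (_ , a≡b))) = contradiction a≡b a≢b

  -- In layer 0, the vertex (x , 0) sees a copy of N[x], while (x , 1) sees (x , 0) alone. Since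
  -- N[x] has at least two elements, no (x , 0) is confused with a (y , 1).
  layer₀-isIDCode : TwinFree H → (∀ x → ∃[ y ] Adj x y) → IsIDCode P layer₀
  layer₀-isIDCode twinFree neighbour = isIDCode⁺ P dom sep
    where
    dom : ∀ x → ∃[ v ] Nbr P x v × _∈ⱽ_ P v layer₀
    dom (x , 0F) = (x , 0F) , inj₁ refl , ∈layer₀⁺ x
    dom (x , 1F) = (x , 0F) , Nbr-cross⁺ (λ ()) , ∈layer₀⁺ x

    layers-differ : ∀ x y → ¬ NbrIn⊆ P layer₀ (x , 0F) (y , 1F)
    layers-differ x y sub = let z , adj = neighbour x in
      irrefl (trans (sym (y≡ (inj₁ refl))) (y≡ (inj₂ adj))) adj
      where
      y≡ : ∀ {z} → Nbr H x z → y ≡ z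
      y≡ {z} nbr = Nbr-cross⁻ (λ ()) (sub (∈layer₀⁺ z) (Nbr-same⁺ nbr))

    sep : ∀ x y → NbrIn⊆ P layer₀ x y → NbrIn⊆ P layer₀ y x → x ≡ y
    sep (x , 0F) (y , 0F) s t = cong (_, 0F) (twinFree x y (restrict s) (restrict t))
      where
      restrict : ∀ {x y} → NbrIn⊆ P layer₀ (x , 0F) (y , 0F) → ∀ {v} → Nbr H x v → Nbr H y v
      restrict s {v} nbr = Nbr-same⁻ (s (∈layer₀⁺ v) (Nbr-same⁺ nbr))
    sep (x , 1F) (y , 1F) s t =
      cong (_, 1F) (sym (Nbr-cross⁻ (λ ()) (s (∈layer₀⁺ x) (Nbr-cross⁺ (λ ())))))
    sep (x , 0F) (y , 1F) s t = contradiction (λ {v} → s {v}) (layers-differ x y)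
    sep (x , 1F) (y , 0F) s t = contradiction (λ {v} → t {v}) (layers-differ y x)

  -- The lower bound, by charging columns to code vertices.

  module _ {C} (code : IsIDCode P C) where
    private
      infix 4 _∈C
      _∈C : V × Fin 2 → Set
      v ∈C = _∈ⱽ_ P v C

    Missed : V → Set
    Missed x = ∀ b → ¬ (x , b) ∈C

    -- N[(x , b)] consists of the column of x, here disjoint from C, and (u , b).
    missed⇒Nbr : ∀ {x u} → Pendant H x u → Missed x →
                 ∀ {b v} → v ∈C → Nbr P (x , b) v → v ≡ (u , b)
    missed⇒Nbr pend miss v∈C (inj₁ refl)                = contradiction v∈C (miss _)
    missed⇒Nbr pend miss v∈C (inj₂ (inj₁ (refl , _)))   = contradiction v∈C (miss _)
    missed⇒Nbr pend miss v∈C (inj₂ (inj₂ (adj , refl))) = cong (_, _) (proj₂ pend adj)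

    missed⇒host∈ : ∀ {x u} → Pendant H x u → Missed x → ∀ b → (u , b) ∈C
    missed⇒host∈ pend miss b = let v , nbr , v∈C = dominated P code (_ , b) in
      subst _∈C (missed⇒Nbr pend miss v∈C nbr) v∈C

    -- Both (x , 0) and (y , 0) can see only (u , 0) in C.
    missed-unique : ∀ {x y u} → Pendant H x u → Pendant H y u → Missed x → Missed y → x ≡ y
    missed-unique {x} {y} {u} pendx pendy missx missy =
      cong proj₁ (separated P code (sub pendx pendy missx) (sub pendy pendx missy))
      where
      sub : ∀ {x y} → Pendant H x u → Pendant H y u → Missed x → NbrIn⊆ P C (x , 0F) (y , 0F)
      sub pendx pendy missx v∈C nbr with missed⇒Nbr pendx missx v∈C nbr
      ... | refl = Nbr-same⁺ (inj₂ (proj₁ pendy))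

    -- Without the column of x, the vertices (ℓ , 0) and (ℓ , 1) see in C only members of the column
    -- of ℓ, and they see the same ones.
    support-not-missed : ∀ {ℓ x} → Pendant H ℓ x → ¬ Missed x
    support-not-missed {ℓ} {x} pend miss =
      contradiction (cong proj₂ (separated P code {ℓ , 0F} {ℓ , 1F} sub sub)) (λ ())
      where
      sub : ∀ {a b} → NbrIn⊆ P C (ℓ , a) (ℓ , b)
      sub {a} {b} v∈C (inj₂ (inj₂ (adj , refl))) with proj₂ pend adj
      ... | refl = contradiction v∈C (miss _)
      sub {b = b} {_ , c} v∈C nbr@(inj₁ refl) with c Fin.≟ b
      ... | yes refl = inj₁ refl
      ... | no c≢b   = Nbr-cross⁺ (c≢b ∘ sym)
      sub {b = b} {_ , c} v∈C (inj₂ (inj₁ (refl , _))) with c Fin.≟ b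
      ... | yes refl = inj₁ refl
      ... | no c≢b   = Nbr-cross⁺ (c≢b ∘ sym)

    -- Indexing by the target lets a collision of two charges be analysed by matching. `high`
    -- records that (x , 0) is absent, to exclude a clash with `missed`.
    data Charge (x : V) : V × Fin 2 → Set where
      low    : Charge x (x , 0F)
      high   : ¬ (x , 0F) ∈C → Charge x (x , 1F)
      missed : ∀ {u} → Pendant H x u → Missed x → Charge x (u , 1F)

    charge : ∀ x → PendantOrSupport H x → ∃[ v ] v ∈C × Charge x v
    charge x kind with Inverse.to (Graph.enum P) (x , 0F) ∈? C
                     | Inverse.to (Graph.enum P) (x , 1F) ∈? C
    ... | yes x₀∈C | _        = _ , x₀∈C , low
    ... | no  x₀∉C | yes x₁∈C = _ , x₁∈C , high x₀∉C
    ... | no  x₀∉C | no  x₁∉C = go kind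
      where
      miss : Missed x
      miss 0F = x₀∉C
      miss 1F = x₁∉C
      go : PendantOrSupport H x → ∃[ v ] v ∈C × Charge x v
      go (inj₁ (_ , pend)) = contradiction miss (support-not-missed pend)
      go (inj₂ (_ , pend)) = _ , missed⇒host∈ pend miss 1F , missed pend miss

    -- Only `low` charges layer 0. In layer 1, `high` at u cannot meet `missed` from a pendant
    -- vertex at u, because the latter forces (u , 0) into C.
    charge-injective : ∀ {x y v} → Charge x v → Charge y v → x ≡ y
    charge-injective low           low             = refl
    charge-injective (high _)      (high _)        = refl
    charge-injective (high x₀∉C)   (missed p m)    = contradiction (missed⇒host∈ p m 0F) x₀∉C
    charge-injective (missed p m)  (high y₀∉C)     = contradiction (missed⇒host∈ p m 0F) y₀∉C
    charge-injective (missed p m)  (missed p′ m′)  = missed-unique p p′ m m′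

    order≤∣C∣ : (∀ x → PendantOrSupport H x) → order ≤ ∣ C ∣
    order≤∣C∣ kind = injective-into⇒≤ C (to-P ∘ target) (λ i → proj₁ (proj₂ (pick i))) inj
      where
      to-P : V × Fin 2 → Fin (order * 2)
      to-P = Inverse.to (Graph.enum P)
      pick : ∀ i → ∃[ v ] v ∈C × Charge (Inverse.from enum i) v
      pick i = charge (Inverse.from enum i) (kind _)
      target : Fin order → V × Fin 2
      target i = proj₁ (pick i)
      inj : ∀ {i j} → to-P (target i) ≡ to-P (target j) → i ≡ j
      inj {i} {j} eq = trans (sym (Inverse.strictlyInverseˡ enum i))
        (trans (cong (Inverse.to enum) same) (Inverse.strictlyInverseˡ enum j))
        where
        same : Inverse.from enum i ≡ Inverse.from enum j
        same = charge-injective (proj₂ (proj₂ (pick i)))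
          (subst (Charge _) (sym (to-injective P eq)) (proj₂ (proj₂ (pick j))))

  -- Absence of isolated vertices and closed twins.

  module _ (kind : ∀ x → PendantOrSupport H x)
           (isolated-edge-free : ∀ {x y} → Pendant H x y → ¬ Pendant H y x) where

    neighbour : ∀ x → ∃[ y ] Adj x y
    neighbour x with kind x
    ... | inj₁ (ℓ , adj , _) = ℓ , symm adj
    ... | inj₂ (u , adj , _) = u , adj

    -- A twin y other than x lies in N[x], so y = u; then N[y] is contained in {x , y}, and xy is an
    -- isolated edge.
    pendant-not-twin : ∀ {x u y} → Pendant H x u → (∀ {v} → Nbr H x v → Nbr H y v) →
                       (∀ {v} → Nbr H y v → Nbr H x v) → x ≡ y
    pendant-not-twin {x} {u} {y} pend s t with t (inj₁ refl)
    ... | inj₁ y≡x = sym y≡x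
    ... | inj₂ x~y with proj₂ pend x~y
    ...   | refl = contradiction (symm x~y , λ {_} → only) (isolated-edge-free pend)
      where
      only : ∀ {z} → Adj y z → z ≡ x
      only {z} y~z with t (inj₂ y~z)
      ... | inj₁ z≡x = z≡x
      ... | inj₂ x~z = contradiction y~z (irrefl (sym (proj₂ pend x~z)))

    -- If x supports ℓ, then ℓ lies in N[y]: either y is the pendant vertex ℓ, or y is the sole
    -- neighbour x of ℓ.
    twinFree : TwinFree H
    twinFree x y s t with kind x
    ... | inj₂ (_ , pend) = pendant-not-twin pend s t
    ... | inj₁ (ℓ , pend) with s (inj₂ (symm (proj₁ pend)))
    ...   | inj₁ refl = sym (pendant-not-twin pend t s)
    ...   | inj₂ y~ℓ  = sym (proj₂ pend (symm y~ℓ))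

    γ≡order : γᴵᴰ[ P ]≡ order
    γ≡order = record
      { attained = layer₀ , layer₀-isIDCode twinFree neighbour , ∣evens∣ order
      ; minimal  = λ C code → order≤∣C∣ code kind
      }

-- Pendant vertices and supports in `attach F host`.

module _ (F : Graph) {k} (host : Fin k → Graph.V F) where
  private
    module F = Graph F
    A : Graph
    A = attach F host

  leaf-pendant : ∀ ℓ → Pendant A (inj₂ ℓ) (inj₁ (host ℓ))
  leaf-pendant ℓ = refl , λ {_} → only
    where
    only : ∀ {z} → Graph.Adj A (inj₂ ℓ) z → z ≡ inj₁ (host ℓ)
    only {inj₁ _} refl = refl

  attach-kind : StrictlySurjective _≡_ host → ∀ x → PendantOrSupport A x
  attach-kind surj (inj₂ ℓ) = inj₂ (_ , leaf-pendant ℓ)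
  attach-kind surj (inj₁ u) with surj u
  ... | ℓ , refl = inj₁ (inj₂ ℓ , leaf-pendant ℓ)

  -- The first edge of a walk from u to some other vertex leads to a neighbour.
  connected⇒neighbour : 2 ≤ F.order → Connected F → ∀ u → ∃[ v ] F.Adj u v
  connected⇒neighbour 2≤ conn u with another 2≤ (Inverse.to F.enum u)
  ... | j , j≢u with conn u (Inverse.from F.enum j)
  ...   | u~v ◅ _ = _ , u~v
  ...   | ε       = contradiction (sym (Inverse.strictlyInverseˡ F.enum j)) j≢u

  -- New vertices are pairwise nonadjacent, so an isolated edge would have an end in F; but such an
  -- end has one neighbour in F and another among the new vertices.
  attach-isolated-edge-free : (∀ u → ∃[ v ] F.Adj u v) → StrictlySurjective _≡_ host →
                              ∀ {x y} → Pendant A x y → ¬ Pendant A y x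
  attach-isolated-edge-free nbr surj = free
    where
    core-not-pendant : ∀ {u y} → ¬ Pendant A (inj₁ u) y
    core-not-pendant {u} (_ , only) with only {inj₁ _} (proj₂ (nbr u)) | only {inj₂ _} (proj₂ (surj u))
    ... | refl | ()
    free : ∀ {x y} → Pendant A x y → ¬ Pendant A y x
    free {inj₁ _}          pend _    = core-not-pendant pend
    free {inj₂ _} {inj₁ _} _    pend = core-not-pendant pend

-- Transport along isomorphisms.

module _ (G H : Graph) (iso : G ≅ H) where
  private
    module G = Graph G
    module H = Graph H
    open Inverse (proj₁ iso) using (to; from; strictlyInverseˡ; strictlyInverseʳ)

    adj⁺ : ∀ {x y} → G.Adj x y → H.Adj (to x) (to y)
    adj⁺ = Equivalence.to (proj₂ iso _ _)

    adj⁻ : ∀ {x y} → H.Adj (to x) (to y) → G.Adj x y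
    adj⁻ = Equivalence.from (proj₂ iso _ _)

  ≅-pendant⁺ : ∀ {x y} → Pendant G x y → Pendant H (to x) (to y)
  ≅-pendant⁺ {x} (adj , only) = adj⁺ adj , λ {z} x~z →
    trans (sym (strictlyInverseˡ z))
      (cong to (only (adj⁻ (subst (H.Adj (to x)) (sym (strictlyInverseˡ z)) x~z))))

  ≅-pendant⁻ : ∀ {x y} → Pendant H (to x) (to y) → Pendant G x y
  ≅-pendant⁻ {x} {y} (adj , only) = adj⁻ adj , λ {z} x~z →
    trans (sym (strictlyInverseʳ z)) (trans (cong from (only (adj⁺ x~z))) (strictlyInverseʳ y))

  ≅-kind : (∀ x → PendantOrSupport H x) → ∀ x → PendantOrSupport G x
  ≅-kind kind x with kind (to x)
  ... | inj₁ (ℓ , pend) =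
    inj₁ (from ℓ , ≅-pendant⁻ (subst (λ m → Pendant H m (to x)) (sym (strictlyInverseˡ ℓ)) pend))
  ... | inj₂ (u , pend) =
    inj₂ (from u , ≅-pendant⁻ (subst (Pendant H (to x)) (sym (strictlyInverseˡ u)) pend))

proposition9 : ∀ (n : ℕ) → 2 ≤ n → ∀ (H : Graph) → H ∈ ℋ n → γᴵᴰ[ H □ K 2 ]≡ Graph.order H
proposition9 n 2≤n H (F , refl , conn , k , host , surj , iso) =
  γ≡order H (≅-kind H A iso (attach-kind F host surj))
    -- An isolated edge of `H` would be mapped to one of `A`.
    (λ p q → attach-isolated-edge-free F host (connected⇒neighbour F host 2≤n conn) surj
               (≅-pendant⁺ H A iso p) (≅-pendant⁺ H A iso q))
  where
  A : Graph
  A = attach F host
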